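{- For every real number $\zeta>\frac{41}{2}$ there exists a positive integer $c=c(\zeta)$ such that every bipartite graph $G$ with maximum degree $\Delta(G)\ge c$ and $|V(G)|\ge \zeta\,\Delta(G)$ satisfies $$\chi_e(G)\le \left\lceil \frac{\Delta(G)}{2}\right\rceil+1.$$
   Context: Graphs have finite vertex sets, no loops, and no parallel edges. $\Delta(G)$ denotes the maximum degree of $G$. A proper $k$-coloring of $G$ (an assignment of colors from a set of $k$ colors to the vertices in which adjacent vertices get distinct colors) is equitable if the sizes of any two of its $k$ color classes differ by at most one. The equitable chromatic number $\chi_e(G)$ is the smallest integer $k$ such that $G$ admits an equitable $k$-coloring. -}

module Defs where

open import Level using (0ℓ)
open import Data.Nat.Base as ℕ using (ℕ; zero; suc; z≤n; s≤s)
import Data.Nat.Properties as ℕₚ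
open import Data.Integer.Base using (+_)
open import Data.Fin.Base using (Fin; finToFun; funToFin)
import Data.Fin.Properties as Finₚ
open import Data.List.Base using (List; []; _∷_; length; filter; map; allFin)
open import Data.List.Extrema.Nat using (max)
open import Data.List.Properties using (filter-≐)
open import Data.List.Relation.Unary.All using (All; []; _∷_)
open import Data.List.Relation.Unary.All.Properties using (all-filter)
open import Data.List.Relation.Unary.AllPairs using (_∷_)
open import Data.List.Relation.Unary.Unique.Propositional using (Unique)
open import Data.List.Relation.Unary.Unique.Propositional.Properties
  using (allFin⁺; filter⁺)
open import Data.Product.Base using (∃; _×_; _,_; proj₁)
open import Data.Rational.Base
  using (ℚ; 0ℚ; 1ℚ; _+_; _*_; _-_; ∣_∣; _<_; _≤_; _/_; 1/_; Positive;
         positive)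
import Data.Rational.Properties as ℚₚ
open import Data.Rational.Solver using (module +-*-Solver)
open import Relation.Binary.Core using (Rel)
open import Relation.Binary.Definitions
  using (Symmetric; Irreflexive; Decidable)
open import Relation.Binary.PropositionalEquality
  using (_≡_; _≢_; _≗_; refl; sym; trans; cong; cong₂; subst)
open import Relation.Nullary
  using (¬_; yes; no; ¬?; _×-dec_; _→-dec_; contradiction)
open import Relation.Nullary.Decidable using (map′)
import Relation.Unary as U

Cauchy : (ℕ → ℚ) → Set
Cauchy x = ∀ ε → 0ℚ < ε → ∃ λ N →
           ∀ m n → N ℕ.≤ m → N ℕ.≤ n → ∣ x m - x n ∣ < ε

record ℝ : Set where
  constructor mkℝ
  field
    seq    : ℕ → ℚ
    cauchy : Cauchy seq

open ℝ public

infix 4 _<ℝ_ _≤ℝ_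

_<ℝ_ : Rel ℝ 0ℓ
x <ℝ y = ∃ λ ε → 0ℚ < ε × ∃ λ N → ∀ n → N ℕ.≤ n → seq x n + ε < seq y n

_≤ℝ_ : Rel ℝ 0ℓ
x ≤ℝ y = ¬ (y <ℝ x)

fromℚ : ℚ → ℝ
fromℚ q = mkℝ (λ _ → q) λ ε 0<ε → 0 , λ _ _ _ _ →
  subst (_< ε) (sym (cong ∣_∣ (ℚₚ.+-inverseʳ q))) 0<ε

fromℕ : ℕ → ℝ
fromℕ n = fromℚ (+ n / 1)

private
  bounded : ∀ x → Cauchy x →
            ∃ λ B → 0ℚ < B × ∃ λ N → ∀ n → N ℕ.≤ n → ∣ x n ∣ ≤ B
  bounded x cx with cx 1ℚ (ℚₚ.positive⁻¹ 1ℚ)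
  ... | N , near = 1ℚ + ∣ x N ∣ , 0<B , N , λ n N≤n → begin
      ∣ x n ∣                ≡⟨ cong ∣_∣ (split (x n) (x N)) ⟩
      ∣ (x n - x N) + x N ∣  ≤⟨ ℚₚ.∣p+q∣≤∣p∣+∣q∣ (x n - x N) (x N) ⟩
      ∣ x n - x N ∣ + ∣ x N ∣
        ≤⟨ ℚₚ.+-monoˡ-≤ ∣ x N ∣ (ℚₚ.<⇒≤ (near n N N≤n ℕₚ.≤-refl)) ⟩
      1ℚ + ∣ x N ∣           ∎
    where
    open ℚₚ.≤-Reasoning
    0<B : 0ℚ < 1ℚ + ∣ x N ∣
    0<B = ℚₚ.+-mono-<-≤ (ℚₚ.positive⁻¹ 1ℚ) (ℚₚ.0≤∣p∣ (x N))
    split : ∀ a b → a ≡ (a - b) + b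
    split = solve 2 (λ a b → a := (a :- b) :+ b) refl
      where open +-*-Solver

  ε-split : ∀ B C ε → 0ℚ < B → 0ℚ < C → 0ℚ < ε →
            ∃ λ δ → 0ℚ < δ × B * δ + δ * C ≡ ε
  ε-split B C ε 0<B 0<C 0<ε = ε * r , 0<δ , eq
    where
    instance
      posε : Positive ε
      posε = positive 0<ε
      posS : Positive (B + C)
      posS = positive (ℚₚ.+-mono-< 0<B 0<C)
    r : ℚ
    r = (1/ (B + C)) ⦃ ℚₚ.pos⇒nonZero (B + C) ⦄
    0<δ : 0ℚ < ε * r
    0<δ = ℚₚ.positive⁻¹ (ε * r)
            ⦃ ℚₚ.pos*pos⇒pos ε r ⦃ ℚₚ.1/pos⇒pos (B + C) ⦄ ⦄
    lem : ∀ b c e s → b * (e * s) + (e * s) * c ≡ e * (s * (b + c))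
    lem = solve 4 (λ b c e s → b :* (e :* s) :+ (e :* s) :* c
                            := e :* (s :* (b :+ c))) refl
      where open +-*-Solver
    eq : B * (ε * r) + (ε * r) * C ≡ ε
    eq = trans (lem B C ε r)
         (trans (cong (ε *_) (ℚₚ.*-inverseˡ (B + C) ⦃ ℚₚ.pos⇒nonZero (B + C) ⦄))
                (ℚₚ.*-identityʳ ε))

  expand : ∀ a b c d → a * c - b * d ≡ a * (c - d) + (a - b) * d
  expand = solve 4 (λ a b c d → a :* c :- b :* d
                             := a :* (c :- d) :+ (a :- b) :* d) refl
    where open +-*-Solver

  product-near : ∀ B C δ → 0ℚ < B → 0ℚ < C → ∀ a b c d →
                 ∣ a ∣ ≤ B → ∣ d ∣ ≤ C → ∣ a - b ∣ < δ → ∣ c - d ∣ < δ →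
                 ∣ a * c - b * d ∣ < B * δ + δ * C
  product-near B C δ 0<B 0<C a b c d a≤B d≤C ab cd = begin-strict
    ∣ a * c - b * d ∣
      ≡⟨ cong ∣_∣ (expand a b c d) ⟩
    ∣ a * (c - d) + (a - b) * d ∣
      ≤⟨ ℚₚ.∣p+q∣≤∣p∣+∣q∣ (a * (c - d)) ((a - b) * d) ⟩
    ∣ a * (c - d) ∣ + ∣ (a - b) * d ∣
      ≡⟨ cong₂ _+_ (ℚₚ.∣p*q∣≡∣p∣*∣q∣ a (c - d)) (ℚₚ.∣p*q∣≡∣p∣*∣q∣ (a - b) d) ⟩
    ∣ a ∣ * ∣ c - d ∣ + ∣ a - b ∣ * ∣ d ∣
      ≤⟨ ℚₚ.+-mono-≤
           (ℚₚ.*-monoʳ-≤-nonNeg ∣ c - d ∣ ⦃ ℚₚ.∣-∣-nonNeg (c - d) ⦄ a≤B)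
           (ℚₚ.*-monoˡ-≤-nonNeg ∣ a - b ∣ ⦃ ℚₚ.∣-∣-nonNeg (a - b) ⦄ d≤C) ⟩
    B * ∣ c - d ∣ + ∣ a - b ∣ * C
      <⟨ ℚₚ.+-mono-< (ℚₚ.*-monoʳ-<-pos B ⦃ positive 0<B ⦄ cd)
                     (ℚₚ.*-monoˡ-<-pos C ⦃ positive 0<C ⦄ ab) ⟩
    B * δ + δ * C ∎
    where open ℚₚ.≤-Reasoning

  *-near : ∀ (x y : ℕ → ℚ) B C δ → 0ℚ < B → 0ℚ < C → ∀ N₁ N₂ N₃ N₄ →
           (∀ n → N₁ ℕ.≤ n → ∣ x n ∣ ≤ B) →
           (∀ n → N₂ ℕ.≤ n → ∣ y n ∣ ≤ C) →
           (∀ m n → N₃ ℕ.≤ m → N₃ ℕ.≤ n → ∣ x m - x n ∣ < δ) →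
           (∀ m n → N₄ ℕ.≤ m → N₄ ℕ.≤ n → ∣ y m - y n ∣ < δ) →
           ∃ λ N → ∀ m n → N ℕ.≤ m → N ℕ.≤ n →
           ∣ x m * y m - x n * y n ∣ < B * δ + δ * C
  *-near x y B C δ 0<B 0<C N₁ N₂ N₃ N₄ x≤B y≤C dx dy =
    (N₁ ℕ.⊔ N₂) ℕ.⊔ (N₃ ℕ.⊔ N₄) , λ m n N≤m N≤n →
      product-near B C δ 0<B 0<C (x m) (x n) (y m) (y n)
        (x≤B m (ℕₚ.m⊔n≤o⇒m≤o N₁ N₂ (left N≤m)))
        (y≤C n (ℕₚ.m⊔n≤o⇒n≤o N₁ N₂ (left N≤n)))
        (dx m n (ℕₚ.m⊔n≤o⇒m≤o N₃ N₄ (right N≤m))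
                (ℕₚ.m⊔n≤o⇒m≤o N₃ N₄ (right N≤n)))
        (dy m n (ℕₚ.m⊔n≤o⇒n≤o N₃ N₄ (right N≤m))
                (ℕₚ.m⊔n≤o⇒n≤o N₃ N₄ (right N≤n)))
    where
    left : ∀ {k} → (N₁ ℕ.⊔ N₂) ℕ.⊔ (N₃ ℕ.⊔ N₄) ℕ.≤ k → N₁ ℕ.⊔ N₂ ℕ.≤ k
    left = ℕₚ.m⊔n≤o⇒m≤o (N₁ ℕ.⊔ N₂) (N₃ ℕ.⊔ N₄)
    right : ∀ {k} → (N₁ ℕ.⊔ N₂) ℕ.⊔ (N₃ ℕ.⊔ N₄) ℕ.≤ k → N₃ ℕ.⊔ N₄ ℕ.≤ k
    right = ℕₚ.m⊔n≤o⇒n≤o (N₁ ℕ.⊔ N₂) (N₃ ℕ.⊔ N₄)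

  *-cauchy : ∀ x y → Cauchy x → Cauchy y → Cauchy (λ n → x n * y n)
  *-cauchy x y cx cy ε 0<ε =
    let B , 0<B , N₁ , x≤B = bounded x cx
        C , 0<C , N₂ , y≤C = bounded y cy
        δ , 0<δ , Bδ+δC≡ε  = ε-split B C ε 0<B 0<C 0<ε
        N₃ , dx = cx δ 0<δ
        N₄ , dy = cy δ 0<δ
        N , near = *-near x y B C δ 0<B 0<C N₁ N₂ N₃ N₄ x≤B y≤C dx dy
    in N , λ m n N≤m N≤n →
       subst (λ e → ∣ x m * y m - x n * y n ∣ < e) Bδ+δC≡ε (near m n N≤m N≤n)

infixl 7 _*ℝ_

_*ℝ_ : ℝ → ℝ → ℝ
x *ℝ y = mkℝ (λ n → seq x n * seq y n)
             (*-cauchy (seq x) (seq y) (cauchy x) (cauchy y))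

-- The vertex set is Fin order, so ∣V(G)∣ is order G.
record Graph : Set₁ where
  infix 4 _~_ _~?_
  field
    order    : ℕ
    _~_      : Rel (Fin order) 0ℓ
    _~?_     : Decidable _~_
    ~-sym    : Symmetric _~_
    ~-irrefl : Irreflexive _≡_ _~_

  degree : Fin order → ℕ
  degree v = length (filter (v ~?_) (allFin order))

open Graph public using (order; degree)

-- The graph without vertices gets maximum degree 0.
Δ : Graph → ℕ
Δ G = max 0 (map (degree G) (allFin (order G)))

Coloring : Graph → ℕ → Set
Coloring G k = Fin (order G) → Fin k

module _ (G : Graph) {k : ℕ} where

  open Graph G using (_~_; _~?_)

  Proper : Coloring G k → Set
  Proper f = ∀ u v → u ~ v → f u ≢ f v

  classSize : Coloring G k → Fin k → ℕ
  classSize f i = length (filter (λ v → f v Finₚ.≟ i) (allFin (order G)))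

  Equitable : Coloring G k → Set
  Equitable f = ∀ i j → ℕ.∣ classSize f i - classSize f j ∣ ℕ.≤ 1

Bipartite : Graph → Set
Bipartite G = ∃ λ (side : Coloring G 2) → Proper G side

EquitablyColorable : Graph → ℕ → Set
EquitablyColorable G k = ∃ λ (f : Coloring G k) → Proper G f × Equitable G f

IsLeast : (ℕ → Set) → ℕ → Set
IsLeast P k = P k × (∀ j → P j → k ℕ.≤ j)

private
  least : ∀ {P : ℕ → Set} → U.Decidable P → ∀ n → P n → ∃ (IsLeast P)
  least P? n pn with P? 0
  least P? n       pn | yes p₀ = 0 , p₀ , λ _ _ → z≤n
  least P? zero    pn | no ¬p₀ = contradiction pn ¬p₀
  least P? (suc n) pn | no ¬p₀ with least (λ k → P? (suc k)) n pn
  ... | k , pk , min = suc k , pk , λ where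
    zero    p₀ → contradiction p₀ ¬p₀
    (suc j) pj → s≤s (min j pj)

  proper? : ∀ G {k} → U.Decidable (Proper G {k})
  proper? G f = Finₚ.all? λ u → Finₚ.all? λ v →
                (u ~? v) →-dec ¬? (f u Finₚ.≟ f v)
    where open Graph G using (_~?_)

  equitable? : ∀ G {k} → U.Decidable (Equitable G {k})
  equitable? G f = Finₚ.all? λ i → Finₚ.all? λ j → _ ℕₚ.≤? 1

  classSize-cong : ∀ G {k} {f g : Coloring G k} → f ≗ g →
                   classSize G f ≗ classSize G g
  classSize-cong G {f = f} {g} f≗g i = cong length
    (filter-≐ (λ v → f v Finₚ.≟ i) (λ v → g v Finₚ.≟ i)
      ((λ {v} → trans (sym (f≗g v))) , (λ {v} → trans (f≗g v)))
      (allFin (order G)))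

  equitablyColorable? : ∀ G → U.Decidable (EquitablyColorable G)
  equitablyColorable? G k = map′
    (λ (c , p) → finToFun c , p)
    (λ (f , p) → funToFin f , resp (λ v → sym (Finₚ.finToFun-funToFin f v)) p)
    (Finₚ.any? λ c → proper? G (finToFun c) ×-dec equitable? G (finToFun c))
    where
    resp : ∀ {f g : Coloring G k} → f ≗ g →
           Proper G f × Equitable G f → Proper G g × Equitable G g
    resp {f} {g} f≗g (p , e) =
      (λ u v u~v gu≡gv →
        p u v u~v (trans (f≗g u) (trans gu≡gv (sym (f≗g v))))) ,
      (λ i j → subst (ℕ._≤ 1)
        (cong₂ ℕ.∣_-_∣ (classSize-cong G f≗g i) (classSize-cong G f≗g j))
        (e i j))

  unique-constant : ∀ {A : Set} {a : A} {xs : List A} →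
                    Unique xs → All (_≡ a) xs → length xs ℕ.≤ 1
  unique-constant {xs = []}        _ _ = z≤n
  unique-constant {xs = _ ∷ []}    _ _ = s≤s z≤n
  unique-constant {xs = _ ∷ _ ∷ _} ((x≢y ∷ _) ∷ _) (x≡a ∷ y≡a ∷ _) =
    contradiction (trans x≡a (sym y≡a)) x≢y

  rainbow : ∀ G → EquitablyColorable G (order G)
  rainbow G = (λ v → v) , proper , λ i j →
    ℕₚ.≤-trans (ℕₚ.∣m-n∣≤m⊔n (size i) (size j)) (ℕₚ.⊔-lub (size≤1 i) (size≤1 j))
    where
    open Graph G using (_~_; ~-irrefl)
    proper : ∀ u v → u ~ v → u ≢ v
    proper u v u~v u≡v = ~-irrefl u≡v u~v
    size : Fin (order G) → ℕ
    size = classSize G (λ v → v)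
    size≤1 : ∀ i → size i ℕ.≤ 1
    size≤1 i = unique-constant (filter⁺ (Finₚ._≟ i) (allFin⁺ (order G)))
                               (all-filter (Finₚ._≟ i) (allFin (order G)))

∃-least-equitable : ∀ G → ∃ (IsLeast (EquitablyColorable G))
∃-least-equitable G = least (equitablyColorable? G) (order G) (rainbow G)

χₑ : Graph → ℕ
χₑ G = proj₁ (∃-least-equitable G)

{-# OPTIONS --safe #-}

-- Let k = ⌈Δ/2⌉ + 1, fix class sizes σ ∈ {s, s+1} with s = ⌊n/k⌋, and let B be the smaller side.
-- Colour B so that every class is filled completely by B or receives at most q = ⌊s/8⌋ + 1
-- vertices of B, all but at most eight classes being full or empty, and the other side
-- A arbitrarily in the remaining places. If u in A is adjacent to a vertex of B in its class j,
-- exchange the colours of u and some w in A whose class avoids B and which has no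
-- neighbour in B of colour j: the classes avoiding B contain at least n − |B| − 8(s+1) vertices,
-- more than the qΔ, about n/4, that can be adjacent to the vertices of B of colour j.
module Submission where

open import Defs
open import Data.Nat.Base using (_+_; _<_; _≤_; _≥_; ⌈_/2⌉)
open import Data.Rational.Base using (_/_)
open import Data.Product.Base using (∃; _×_)
open import Data.Bool.Base using (if_then_else_)
open import Data.Nat.Base as ℕ
  using (ℕ; zero; suc; _∸_; _*_; _⊓_; z≤n; s≤s; s≤s⁻¹; z<s; >-nonZero)
import Data.Nat.DivMod as ℕ
open import Data.Nat.Properties as ℕₚ hiding (_≟_)
open import Data.Nat.Tactic.RingSolver using (solve-∀)
open import Data.Fin.Base using (Fin; toℕ; opposite) renaming (zero to fzero; suc to fsuc)
open import Data.Fin.Permutation using (transpose; _⟨$⟩ʳ_)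
open import Data.Fin.Properties using (_≟_; opposite-involutive)
import Data.Integer.Base as ℤ
import Data.Integer.Properties as ℤₚ
open import Data.List.Base using (List; []; _∷_; length; filter; tabulate; allFin)
open import Data.List.Extrema.Nat using (v≤max⁺)
open import Data.List.Membership.Propositional.Properties using (∈-allFin; ∈-map⁺)
open import Data.List.Relation.Unary.All as All using (All; []; _∷_)
import Data.List.Relation.Unary.Any as Any
open import Data.Product.Base using (_,_; proj₂)
open import Data.Rational.Base as ℚ using (0ℚ; 1ℚ; toℚᵘ)
import Data.Rational.Properties as ℚₚ
import Data.Rational.Unnormalised.Base as ℚᵘ
import Data.Rational.Unnormalised.Properties as ℚᵘₚ
open import Data.Sum.Base using (_⊎_; inj₁; inj₂)
open import Function.Base using (_∘_; id)
open import Relation.Binary.PropositionalEquality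
open import Relation.Nullary using (Dec; yes; no; does; contradiction)
import Relation.Unary as U
open import Algebra.Properties.Semiring.Sum ℕₚ.+-*-semiring
  using (sum; sum-cong-≗; ∑-comm; ∑-distrib-+; sum-permute; *-distribˡ-sum; *-distribʳ-sum)

private
  variable
    P : Set
    m n k p : ℕ

-- Indicators and sums over finite sets.

⟦_⟧ : Dec P → ℕ
⟦ d ⟧ = if does d then 1 else 0

⟦⟧-true : (d : Dec P) → P → ⟦ d ⟧ ≡ 1
⟦⟧-true (yes _) _ = refl
⟦⟧-true (no ¬p) p = contradiction p ¬p

⟦⟧-pos : (d : Dec P) → 0 < ⟦ d ⟧ → P
⟦⟧-pos (yes p) _ = p

sum-mono-≤ : {f g : Fin n → ℕ} → (∀ i → f i ≤ g i) → sum f ≤ sum g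
sum-mono-≤ {zero}  f≤g = z≤n
sum-mono-≤ {suc n} f≤g = +-mono-≤ (f≤g fzero) (sum-mono-≤ (f≤g ∘ fsuc))

sum-<⇒∃< : (f g : Fin n → ℕ) → sum f < sum g → ∃ λ i → f i < g i
sum-<⇒∃< {suc n} f g ∑f<∑g with f fzero <? g fzero
... | yes f₀<g₀ = fzero , f₀<g₀
... | no  f₀≮g₀ with sum-<⇒∃< (f ∘ fsuc) (g ∘ fsuc)
                      (+-cancelˡ-< (f fzero) _ _ (<-≤-trans ∑f<∑g (+-monoˡ-≤ _ (≮⇒≥ f₀≮g₀))))
...   | i , fᵢ<gᵢ = fsuc i , fᵢ<gᵢ

term≤sum : (f : Fin n → ℕ) → ∀ i → f i ≤ sum f
term≤sum f fzero    = m≤m+n _ _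
term≤sum f (fsuc i) = ≤-trans (term≤sum (f ∘ fsuc) i) (m≤n+m _ _)

sum-zero : ∀ n → sum {n} (λ _ → 0) ≡ 0
sum-zero zero    = refl
sum-zero (suc n) = sum-zero n

sum-one : ∀ n → sum {n} (λ _ → 1) ≡ n
sum-one zero    = refl
sum-one (suc n) = cong suc (sum-one n)

sum-const : ∀ n x → sum {n} (λ _ → x) ≡ n * x
sum-const zero    x = refl
sum-const (suc n) x = cong (x +_) (sum-const n x)

sum-kronecker : (g : Fin n → ℕ) → ∀ i → sum (λ j → g j * ⟦ i ≟ j ⟧) ≡ g i
sum-kronecker {suc n} g fzero = begin
  g fzero * 1 + sum (λ j → g (fsuc j) * 0)  ≡⟨ cong₂ _+_ (*-identityʳ _) (sum-cong-≗ λ j → *-zeroʳ (g (fsuc j))) ⟩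
  g fzero + sum {n} (λ _ → 0)               ≡⟨ cong (g fzero +_) (sum-zero n) ⟩
  g fzero + 0                               ≡⟨ +-identityʳ _ ⟩
  g fzero                                   ∎
  where open ≡-Reasoning
sum-kronecker {suc n} g (fsuc i) =
  cong₂ _+_ (*-zeroʳ (g fzero)) (sum-kronecker (g ∘ fsuc) i)

-- Double counting: each `g (f v)` is a Kronecker sum over colours, and the two sums are
-- interchanged. It turns a count of vertices into a weighted sum of class sizes.
sum-∘ : (g : Fin k → ℕ) (f : Fin n → Fin k) →
        sum (g ∘ f) ≡ sum (λ j → g j * sum (λ v → ⟦ f v ≟ j ⟧))
sum-∘ {k} {n} g f = begin
  sum (g ∘ f)                                 ≡⟨ sum-cong-≗ (λ v → sum-kronecker g (f v)) ⟨
  sum (λ v → sum (λ j → g j * ⟦ f v ≟ j ⟧))   ≡⟨ ∑-comm (λ v j → g j * ⟦ f v ≟ j ⟧) ⟩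
  sum (λ j → sum (λ v → g j * ⟦ f v ≟ j ⟧))   ≡⟨ sum-cong-≗ (λ j → *-distribˡ-sum (g j) (λ v → ⟦ f v ≟ j ⟧)) ⟨
  sum (λ j → g j * sum (λ v → ⟦ f v ≟ j ⟧))   ∎
  where open ≡-Reasoning

length-filter-tabulate : {A : Set} {Q : A → Set} (Q? : U.Decidable Q) (g : Fin n → A) →
                         length (filter Q? (tabulate g)) ≡ sum (λ i → ⟦ Q? (g i) ⟧)
length-filter-tabulate {zero}  Q? g = refl
length-filter-tabulate {suc n} Q? g with Q? (g fzero)
... | yes _ = cong suc (length-filter-tabulate Q? (g ∘ fsuc))
... | no  _ = length-filter-tabulate Q? (g ∘ fsuc)

-- Colourings with prescribed counts on each side.

sum-decrement : (c : Fin k → ℕ) → sum c ≡ suc m →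
                ∃ λ j → ∃ λ c′ → (∀ i → c i ≡ ⟦ j ≟ i ⟧ + c′ i) × sum c′ ≡ m
sum-decrement {suc k} c eq with c fzero in c₀
... | suc x = fzero , (λ { fzero → x ; (fsuc i) → c (fsuc i) }) ,
              (λ { fzero → c₀ ; (fsuc i) → refl }) , suc-injective eq
... | zero with sum-decrement (c ∘ fsuc) eq
...   | j , c′ , c≗ , ∑c′ = fsuc j , (λ { fzero → 0 ; (fsuc i) → c′ i }) ,
                            (λ { fzero → c₀ ; (fsuc i) → c≗ i }) , ∑c′

-- Greedy induction on the vertices: the first one takes any colour that still has capacity for its
-- side, and that capacity drops by one. Since capacities and vertices of each side agree in total,
-- a colour is always available and every capacity is used up.
∃-prescribed-counts :
  (side : Fin n → Fin p) (cap : Fin p → Fin k → ℕ) →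
  (∀ c → sum (cap c) ≡ sum (λ v → ⟦ side v ≟ c ⟧)) →
  ∃ λ (f : Fin n → Fin k) →
    ∀ c j → sum (λ v → ⟦ side v ≟ c ⟧ * ⟦ f v ≟ j ⟧) ≡ cap c j
∃-prescribed-counts {zero} side cap ∑cap =
  (λ ()) , λ c j → sym (n≤0⇒n≡0 (≤-trans (term≤sum (cap c) j) (≤-reflexive (∑cap c))))
∃-prescribed-counts {suc n} {p} {k} side cap ∑cap =
  let j₀ , cap₀ , cap≗ , ∑cap₀ = sum-decrement (cap c₀)
        (trans (∑cap c₀) (cong (_+ sum (λ v → ⟦ side (fsuc v) ≟ c₀ ⟧)) (⟦⟧-true (c₀ ≟ c₀) refl)))
      f , counts = ∃-prescribed-counts (side ∘ fsuc) (cap′ cap₀) (∑cap′ cap₀ ∑cap₀)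
  in (λ { fzero → j₀ ; (fsuc v) → f v }) , λ c j →
     trans (cong (⟦ c₀ ≟ c ⟧ * ⟦ j₀ ≟ j ⟧ +_) (counts c j)) (restore j₀ cap₀ cap≗ c j)
  where
  c₀ = side fzero

  cap′ : (Fin k → ℕ) → Fin p → Fin k → ℕ
  cap′ cap₀ c with c₀ ≟ c
  ... | yes _ = cap₀
  ... | no  _ = cap c

  ∑cap′ : ∀ cap₀ → sum cap₀ ≡ sum (λ v → ⟦ side (fsuc v) ≟ c₀ ⟧) →
          ∀ c → sum (cap′ cap₀ c) ≡ sum (λ v → ⟦ side (fsuc v) ≟ c ⟧)
  ∑cap′ cap₀ eq c with c₀ ≟ c | ∑cap c
  ... | yes refl | _   = eq
  ... | no  _    | eq′ = eq′

  restore : ∀ j₀ cap₀ → (∀ i → cap c₀ i ≡ ⟦ j₀ ≟ i ⟧ + cap₀ i) →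
            ∀ c j → ⟦ c₀ ≟ c ⟧ * ⟦ j₀ ≟ j ⟧ + cap′ cap₀ c j ≡ cap c j
  restore j₀ cap₀ cap≗ c j with c₀ ≟ c
  ... | yes refl = trans (cong (_+ cap₀ j) (+-identityʳ _)) (sym (cap≗ j))
  ... | no  _    = refl

-- Class sizes and the distribution of one side over the classes.

balanced : ∀ k s r → r ≤ k → ∃ λ (σ : Fin k → ℕ) →
           sum σ ≡ r + k * s × (∀ j → s ≤ σ j) × (∀ j → σ j ≤ suc s)
balanced k s zero _ = (λ _ → s) , sum-const k s , (λ _ → ≤-refl) , λ _ → n≤1+n s
balanced (suc k) s (suc r) (s≤s r≤k) with balanced k s r r≤k
... | σ , ∑σ , s≤σ , σ≤1+s =
  (λ { fzero → suc s ; (fsuc j) → σ j }) ,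
  trans (cong (suc s +_) ∑σ) (shuffle r k s) ,
  (λ { fzero → n≤1+n s ; (fsuc j) → s≤σ j }) ,
  (λ { fzero → ≤-refl ; (fsuc j) → σ≤1+s j })
  where
  shuffle : ∀ r k s → suc s + (r + k * s) ≡ suc r + (s + k * s)
  shuffle = solve-∀

-- The total size of the classes that receive nothing under β.
unused : (σ β : Fin k → ℕ) → ℕ
unused σ β = sum (λ j → ⟦ β j ℕₚ.≟ 0 ⟧ * σ j)

module _ (t q : ℕ) (0<t : 0 < t) where

  -- Each of the first `l` classes takes as much of the remaining `x` as the quota `q` allows. Only
  -- these classes can receive anything, and their sizes add up to at most `l * t`.
  spread : ∀ l x (σ : Fin k → ℕ) → (∀ j → σ j ≤ t) → (∀ j → q ≤ σ j) →
           x ≤ l * q → l * t ≤ sum σ →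
           ∃ λ β → (∀ j → β j ≤ σ j) × sum β ≡ x × (∀ j → β j ≤ q) ×
                   sum σ ≤ unused σ β + l * t
  spread {k} zero x σ _ _ x≤0 _ =
    (λ _ → 0) , (λ _ → z≤n) , trans (sum-zero k) (sym (n≤0⇒n≡0 x≤0)) , (λ _ → z≤n) ,
    ≤-reflexive (sym (trans (+-identityʳ _) (sum-cong-≗ λ j → +-identityʳ (σ j))))
  spread {zero} (suc l) x σ _ _ _ lt≤0 =
    -- The classes cannot run out early: their total size is at least `t` for every class still due,
    -- and `t` is positive.
    contradiction (≤-trans (m≤m+n t (l * t)) lt≤0) (<⇒≱ 0<t)
  spread {suc k} (suc l) x σ σ≤t q≤σ x≤lq lt≤∑ =
    let β , β≤σ , ∑β , β≤q , ∑σ≤ =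
          spread l (x ∸ q) (σ ∘ fsuc) (σ≤t ∘ fsuc) (q≤σ ∘ fsuc)
            (≤-trans (∸-monoˡ-≤ q x≤lq) (≤-reflexive (m+n∸m≡n q (l * q))))
            (+-cancelˡ-≤ t _ _ (≤-trans lt≤∑ (+-monoˡ-≤ _ (σ≤t fzero))))
        x₀ = ⟦ x ⊓ q ℕₚ.≟ 0 ⟧ * σ fzero
        u  = unused (σ ∘ fsuc) β
    in (λ { fzero → x ⊓ q ; (fsuc j) → β j }) ,
       (λ { fzero → ≤-trans (m⊓n≤n x q) (q≤σ fzero) ; (fsuc j) → β≤σ j }) ,
       trans (cong (x ⊓ q +_) ∑β) (m⊓n+m∸n≡m x q) ,
       (λ { fzero → m⊓n≤n x q ; (fsuc j) → β≤q j }) ,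
       (begin
         σ fzero + sum (σ ∘ fsuc)  ≤⟨ +-mono-≤ (σ≤t fzero) ∑σ≤ ⟩
         t + (u + l * t)           ≡⟨ swap t u (l * t) ⟩
         -- The first class is charged `t` even if it stays empty, so its own contribution `x₀` can
         -- be added freely.
         u + (t + l * t)           ≤⟨ +-monoˡ-≤ _ (m≤n+m u x₀) ⟩
         x₀ + u + (t + l * t)      ∎)
    where
    open ≤-Reasoning
    swap : ∀ a b c → a + (b + c) ≡ b + (a + c)
    swap = solve-∀
    m⊓n+m∸n≡m : ∀ m n → m ⊓ n + (m ∸ n) ≡ m
    m⊓n+m∸n≡m m n = trans (cong (_+ (m ∸ n)) (⊓-comm m n)) (m⊓n+n∸m≡n n m)

  -- Classes are filled completely as long as possible; the remainder, which is
  -- smaller than one class, is spread over l classes.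
  fill : ∀ l b (σ : Fin k → ℕ) → (∀ j → σ j ≤ t) → (∀ j → q ≤ σ j) →
         t ≤ suc (l * q) → b + l * t ≤ sum σ →
         ∃ λ β → (∀ j → β j ≤ σ j) × sum β ≡ b × (∀ j → β j ≡ σ j ⊎ β j ≤ q) ×
                 sum σ ≤ unused σ β + (b + l * t)
  fill {zero} l b σ _ _ _ b≤0 =
    (λ ()) , (λ ()) , sym (n≤0⇒n≡0 (m+n≤o⇒m≤o b b≤0)) , (λ ()) , z≤n
  fill {suc k} l b σ σ≤t q≤σ t≤1+lq b≤∑ with σ fzero ≤? b
  ... | no  σ₀≰b =
    let β , β≤σ , ∑β , β≤q , ∑σ≤ =
          spread l b σ σ≤t q≤σ
            (s≤s⁻¹ (≤-trans (≰⇒> σ₀≰b) (≤-trans (σ≤t fzero) t≤1+lq)))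
            (m+n≤o⇒n≤o b b≤∑)
    in β , β≤σ , ∑β , inj₂ ∘ β≤q ,
       ≤-trans ∑σ≤ (+-monoʳ-≤ (unused σ β) (m≤n+m (l * t) b))
  ... | yes σ₀≤b =
    let β , β≤σ , ∑β , full⊎β≤q , ∑σ≤ =
          fill l (b ∸ σ fzero) (σ ∘ fsuc) (σ≤t ∘ fsuc) (q≤σ ∘ fsuc) t≤1+lq
            (+-cancelˡ-≤ (σ fzero) _ _ (subst (_≤ sum σ) (sym (regroup (l * t))) b≤∑))
        x₀ = ⟦ σ fzero ℕₚ.≟ 0 ⟧ * σ fzero
        u  = unused (σ ∘ fsuc) β
    in (λ { fzero → σ fzero ; (fsuc j) → β j }) ,
       (λ { fzero → ≤-refl ; (fsuc j) → β≤σ j }) ,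
       trans (cong (σ fzero +_) ∑β) (m+[n∸m]≡n σ₀≤b) ,
       (λ { fzero → inj₁ refl ; (fsuc j) → full⊎β≤q j }) ,
       (begin
         σ fzero + sum (σ ∘ fsuc)                   ≤⟨ +-monoʳ-≤ (σ fzero) ∑σ≤ ⟩
         σ fzero + (u + (b ∸ σ fzero + l * t))      ≡⟨ swap (σ fzero) u _ ⟩
         u + (σ fzero + (b ∸ σ fzero + l * t))      ≡⟨ cong (u +_) (regroup (l * t)) ⟩
         u + (b + l * t)                            ≤⟨ +-monoˡ-≤ _ (m≤n+m u x₀) ⟩
         x₀ + u + (b + l * t)                       ∎)
    where
    open ≤-Reasoning
    swap : ∀ a b c → a + (b + c) ≡ b + (a + c)
    swap = solve-∀
    regroup : ∀ y → σ fzero + (b ∸ σ fzero + y) ≡ b + y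
    regroup y = trans (sym (+-assoc (σ fzero) _ y)) (cong (_+ y) (m+[n∸m]≡n σ₀≤b))

-- Making a colouring proper by exchanging colours.

-- Indexed by the image of `l`, so that matching on the view also replaces the transposed vertex by
-- its value.
data TransposeView (i j l : Fin n) : Fin n → Set where
  first  : l ≡ i → TransposeView i j l j
  second : l ≡ j → TransposeView i j l i
  other  : l ≢ i → TransposeView i j l l

transposeView : (i j l : Fin n) → TransposeView i j l (transpose i j ⟨$⟩ʳ l)
transposeView i j l with l ≟ i
... | yes l≡i = first l≡i
... | no l≢i with l ≟ j
...   | yes l≡j = second l≡j
...   | no  _   = other l≢i

degree-sum : ∀ G v → degree G v ≡ sum (λ w → ⟦ Graph._~?_ G v w ⟧)
degree-sum G v = length-filter-tabulate (Graph._~?_ G v) id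

classSize-sum : ∀ G (f : Coloring G k) i → classSize G f i ≡ sum (λ v → ⟦ f v ≟ i ⟧)
classSize-sum G f i = length-filter-tabulate (λ v → f v ≟ i) id

degree≤Δ : ∀ G v → degree G v ≤ Δ G
degree≤Δ G v = v≤max⁺ 0 _ (inj₂ (Any.map ≤-reflexive (∈-map⁺ (degree G) (∈-allFin v))))

module _ (G : Graph) (side : Coloring G 2) (side-proper : Proper G side) where

  open Graph G using (_~_; _~?_; ~-sym)

  private
    V = Fin (order G)

  -- The side `fzero` plays the role of B; the exchanges leave its colours fixed.
  inside : V → ℕ
  inside v = ⟦ side v ≟ fzero ⟧

  insideCount : Coloring G k → Fin k → ℕ
  insideCount f j = sum (λ v → inside v * ⟦ f v ≟ j ⟧)

  Clean : Coloring G k → V → Set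
  Clean f u = ∀ v → side v ≡ fzero → u ~ v → f u ≢ f v

  -- Every edge joins the two sides, so a conflict would always be visible from its outside end.
  clean⇒proper : (f : Coloring G k) → (∀ u → side u ≢ fzero → Clean f u) → Proper G f
  clean⇒proper f clean u v u~v fu≡fv with side u in su | side v in sv
  ... | fzero      | fzero      = side-proper u v u~v (trans su (sym sv))
  ... | fsuc fzero | fsuc fzero = side-proper u v u~v (trans su (sym sv))
  ... | fzero      | fsuc fzero = clean v (λ sv′ → 0≢1+n (cong toℕ (trans (sym sv′) sv))) u su (~-sym u~v) (sym fu≡fv)
  ... | fsuc fzero | fzero      = clean u (λ su′ → 0≢1+n (cong toℕ (trans (sym su′) su))) v sv u~v fu≡fv

  module _ (β σ : Fin k → ℕ) where

    -- The invariant of the exchanges. `room` says that the vertices in classes avoiding B outnumber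
    -- all neighbours that the `β (f u)` inside vertices in the class of `u` can have.
    record Layout (f : Coloring G k) : Set where
      field
        insideCounts : ∀ j → insideCount f j ≡ β j
        sizes        : ∀ j → sum (λ v → ⟦ f v ≟ j ⟧) ≡ σ j
        room         : ∀ u → side u ≢ fzero →
                       β (f u) * Δ G < sum (λ w → ⟦ β (f w) ℕₚ.≟ 0 ⟧)

    open Layout

    private
      -- The number of inside neighbours of `w` with colour `j`; it vanishes exactly when `w` may
      -- take that colour without a conflict with B.
      blocked : Coloring G k → Fin k → V → ℕ
      blocked f j w = sum (λ v → inside v * ⟦ f v ≟ j ⟧ * ⟦ v ~? w ⟧)

    -- The edges leaving the inside vertices of colour `j` are counted from both ends.
    sum-blocked : ∀ f → Layout f → ∀ j → sum (blocked f j) ≤ β j * Δ G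
    sum-blocked f L j = begin
      sum (λ w → sum (λ v → x v * ⟦ v ~? w ⟧))  ≡⟨ ∑-comm (λ w v → x v * ⟦ v ~? w ⟧) ⟩
      sum (λ v → sum (λ w → x v * ⟦ v ~? w ⟧))  ≡⟨ sum-cong-≗ (λ v → *-distribˡ-sum (x v) (λ w → ⟦ v ~? w ⟧)) ⟨
      sum (λ v → x v * sum (λ w → ⟦ v ~? w ⟧))  ≤⟨ sum-mono-≤ (λ v → *-monoʳ-≤ (x v)
                                                     (≤-trans (≤-reflexive (sym (degree-sum G v))) (degree≤Δ G v))) ⟩
      sum (λ v → x v * Δ G)                     ≡⟨ *-distribʳ-sum (Δ G) x ⟨
      sum x * Δ G                               ≡⟨ cong (_* Δ G) (insideCounts L j) ⟩
      β j * Δ G                                 ∎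
      where
      open ≤-Reasoning
      x : V → ℕ
      x v = inside v * ⟦ f v ≟ j ⟧

    inside⇒β>0 : ∀ f → Layout f → ∀ v → side v ≡ fzero → 1 ≤ β (f v)
    inside⇒β>0 f L v sv = begin
      1                             ≡⟨ cong₂ _*_ (⟦⟧-true (side v ≟ fzero) sv) (⟦⟧-true (f v ≟ f v) refl) ⟨
      inside v * ⟦ f v ≟ f v ⟧      ≤⟨ term≤sum (λ w → inside w * ⟦ f w ≟ f v ⟧) v ⟩
      insideCount f (f v)           ≡⟨ insideCounts L (f v) ⟩
      β (f v)                       ∎
      where open ≤-Reasoning

    -- Pigeonhole: by `room`, some `w` has `blocked` smaller than the indicator of lying in a class
    -- that avoids B. The indicator is then 1 and `blocked` is 0.
    ∃-partner : ∀ f → Layout f → ∀ u → side u ≢ fzero →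
                ∃ λ w → β (f w) ≡ 0 × (∀ v → side v ≡ fzero → w ~ v → f u ≢ f v)
    ∃-partner f L u su with sum-<⇒∃< (blocked f (f u)) (λ w → ⟦ β (f w) ℕₚ.≟ 0 ⟧)
                              (≤-<-trans (sum-blocked f L (f u)) (room L u su))
    ... | w , bw<1 = w , ⟦⟧-pos (β (f w) ℕₚ.≟ 0) (≤-<-trans z≤n bw<1) , λ v sv w~v fu≡fv →
      <⇒≱ bw<1 (begin
        ⟦ β (f w) ℕₚ.≟ 0 ⟧                                   ≤⟨ ⟦⟧≤1 (β (f w) ℕₚ.≟ 0) ⟩
        1                                                    ≡⟨ cong₂ _*_ (cong₂ _*_ (⟦⟧-true (side v ≟ fzero) sv)
                                                                 (⟦⟧-true (f v ≟ f u) (sym fu≡fv)))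
                                                                 (⟦⟧-true (v ~? w) (~-sym w~v)) ⟨
        inside v * ⟦ f v ≟ f u ⟧ * ⟦ v ~? w ⟧                ≤⟨ term≤sum (λ v → inside v * ⟦ f v ≟ f u ⟧ * ⟦ v ~? w ⟧) v ⟩
        blocked f (f u) w                                    ∎)
      where
      open ≤-Reasoning
      ⟦⟧≤1 : (d : Dec P) → ⟦ d ⟧ ≤ 1
      ⟦⟧≤1 (yes _) = ≤-refl
      ⟦⟧≤1 (no  _) = z≤n

    -- Exchanging the colours of u and w makes both clean, because f w is used by no
    -- vertex inside, and no other vertex loses cleanness.
    clean-step : ∀ f → Layout f → ∀ u → side u ≢ fzero →
                 ∃ λ f′ → Layout f′ × Clean f′ u ×
                   (∀ x → side x ≢ fzero → Clean f x → Clean f′ x)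
    clean-step f L u su with ∃-partner f L u su
    ... | w , βw≡0 , w-free = f ∘ π , L′ , clean-u , clean-mono
      where
      π : V → V
      π = transpose u w ⟨$⟩ʳ_

      -- The class of `w` avoids B, so `w` lies outside and the exchange moves no inside vertex.
      sw : side w ≢ fzero
      sw sw≡0 = <⇒≱ (inside⇒β>0 f L w sw≡0) (≤-reflexive βw≡0)

      π-fixes : ∀ v → side v ≡ fzero → π v ≡ v
      π-fixes v sv with π v | transposeView u w v
      ... | _ | first  refl = contradiction sv su
      ... | _ | second refl = contradiction sv sw
      ... | _ | other _     = refl

      π-outside : ∀ v → side v ≢ fzero → side (π v) ≢ fzero
      π-outside v sv with π v | transposeView u w v
      ... | _ | first  _ = sw
      ... | _ | second _ = su
      ... | _ | other _  = sv

      sum-π : ∀ (g : V → ℕ) → sum (g ∘ π) ≡ sum g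
      sum-π g = sym (sum-permute g (transpose u w))

      same-inside : ∀ j v → inside v * ⟦ f (π v) ≟ j ⟧ ≡ inside v * ⟦ f v ≟ j ⟧
      same-inside j v with side v ≟ fzero
      ... | yes sv = cong (λ x → 1 * ⟦ f x ≟ j ⟧) (π-fixes v sv)
      ... | no  _  = refl

      L′ : Layout (f ∘ π)
      L′ = record
        { insideCounts = λ j → trans (sum-cong-≗ (same-inside j)) (insideCounts L j)
        ; sizes        = λ j → trans (sum-π (λ v → ⟦ f v ≟ j ⟧)) (sizes L j)
        ; room         = λ v sv → subst (β (f (π v)) * Δ G <_)
                           (sym (sum-π (λ x → ⟦ β (f x) ℕₚ.≟ 0 ⟧))) (room L (π v) (π-outside v sv))
        }

      w-colour : ∀ v → side v ≡ fzero → f w ≢ f v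
      w-colour v sv fw≡fv =
        <⇒≱ (inside⇒β>0 f L v sv) (≤-reflexive (trans (cong β (sym fw≡fv)) βw≡0))

      clean-u : Clean (f ∘ π) u
      clean-u v sv u~v eq with π u | transposeView u w u | trans eq (cong f (π-fixes v sv))
      ... | _ | first  _    | fw≡fv = w-colour v sv fw≡fv
      ... | _ | second refl | fw≡fv = w-colour v sv fw≡fv
      ... | _ | other u≢u   | _     = contradiction refl u≢u

      clean-mono : ∀ x → side x ≢ fzero → Clean f x → Clean (f ∘ π) x
      clean-mono x sx cx v sv x~v eq with π x | transposeView u w x | trans eq (cong f (π-fixes v sv))
      ... | _ | first  _    | fw≡fv = w-colour v sv fw≡fv
      -- Here `x` is `w`, which takes over the old colour of `u`; it was chosen without inside
      -- neighbours of that colour.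
      ... | _ | second refl | fu≡fv = w-free v sv x~v fu≡fv
      ... | _ | other _     | fx≡fv = cx v sv x~v fx≡fv

    -- Cleanness survives later exchanges, so at most one exchange per listed vertex suffices.
    resolve : ∀ f → Layout f → (us : List V) →
              ∃ λ f′ → Layout f′ × All (λ u → side u ≢ fzero → Clean f′ u) us
    resolve f L []       = f , L , []
    resolve f L (u ∷ us) with resolve f L us
    ... | f₁ , L₁ , clean-us with side u ≟ fzero
    ...   | yes su = f₁ , L₁ , contradiction su ∷ clean-us
    ...   | no  su with clean-step f₁ L₁ u su
    ...     | f₂ , L₂ , clean-u , mono =
      f₂ , L₂ , (λ _ → clean-u) ∷ All.map (λ {x} cx sx → mono x sx (cx sx)) clean-us

    layout⇒proper : ∀ f → Layout f → ∃ λ f′ → Proper G f′ × (∀ j → classSize G f′ j ≡ σ j)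
    layout⇒proper f L with resolve f L (allFin (order G))
    ... | f′ , L′ , clean =
      f′ , clean⇒proper f′ (λ u → All.lookup clean (∈-allFin u)) ,
      λ j → trans (classSize-sum G f′ j) (sizes L′ j)

  -- The initial layout and the resulting equitable colouring.

  counts-split : (x : V → ℕ) →
    sum (λ v → ⟦ side v ≟ fzero ⟧ * x v) + sum (λ v → ⟦ side v ≟ fsuc fzero ⟧ * x v) ≡ sum x
  counts-split x = trans (sym (∑-distrib-+ (λ v → ⟦ side v ≟ fzero ⟧ * x v) _)) (sum-cong-≗ pointwise)
    where
    pointwise : ∀ v → ⟦ side v ≟ fzero ⟧ * x v + ⟦ side v ≟ fsuc fzero ⟧ * x v ≡ x v
    pointwise v with side v
    ... | fzero      = trans (+-identityʳ _) (+-identityʳ _)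
    ... | fsuc fzero = +-identityʳ _

  sides-split : sum inside + sum (λ v → ⟦ side v ≟ fsuc fzero ⟧) ≡ order G
  sides-split = begin
    sum inside + sum (λ v → ⟦ side v ≟ fsuc fzero ⟧)
      ≡⟨ cong₂ _+_ (sum-cong-≗ λ v → *-identityʳ (inside v)) (sum-cong-≗ λ v → *-identityʳ ⟦ side v ≟ fsuc fzero ⟧) ⟨
    sum (λ v → inside v * 1) + sum (λ v → ⟦ side v ≟ fsuc fzero ⟧ * 1)
      ≡⟨ counts-split (λ _ → 1) ⟩
    sum {order G} (λ _ → 1)
      ≡⟨ sum-one (order G) ⟩
    order G ∎
    where open ≡-Reasoning

  -- The other side takes the `σ j ∸ β j` remaining places. A class filled by B has no place for an
  -- outside vertex, so the class of any outside vertex holds at most `q` inside vertices, and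
  -- `enough` yields `room`.
  counts⇒layout : (β σ : Fin k → ℕ) (q : ℕ) → (∀ j → β j ≤ σ j) →
                  sum β ≡ sum inside → sum σ ≡ order G →
                  (∀ j → β j ≡ σ j ⊎ β j ≤ q) → q * Δ G < unused σ β →
                  ∃ (Layout β σ)
  counts⇒layout {k} β σ q β≤σ ∑β ∑σ full⊎small enough =
    let f , counts = ∃-prescribed-counts side cap ∑cap in f , layout f counts
    where
    cap : Fin 2 → Fin k → ℕ
    cap fzero    = β
    cap (fsuc _) = λ j → σ j ∸ β j

    ∑cap : ∀ c → sum (cap c) ≡ sum (λ v → ⟦ side v ≟ c ⟧)
    ∑cap fzero        = ∑β
    ∑cap (fsuc fzero) = +-cancelˡ-≡ (sum β) _ _ (begin
      sum β + sum (λ j → σ j ∸ β j)                    ≡⟨ ∑-distrib-+ β _ ⟨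
      sum (λ j → β j + (σ j ∸ β j))                    ≡⟨ sum-cong-≗ (λ j → m+[n∸m]≡n (β≤σ j)) ⟩
      sum σ                                            ≡⟨ ∑σ ⟩
      order G                                          ≡⟨ sides-split ⟨
      sum inside + sum (λ v → ⟦ side v ≟ fsuc fzero ⟧) ≡⟨ cong (_+ sum (λ v → ⟦ side v ≟ fsuc fzero ⟧)) ∑β ⟨
      sum β + sum (λ v → ⟦ side v ≟ fsuc fzero ⟧)      ∎)
      where open ≡-Reasoning

    module _ (f : Coloring G k)
             (counts : ∀ c j → sum (λ v → ⟦ side v ≟ c ⟧ * ⟦ f v ≟ j ⟧) ≡ cap c j) where

      sizes′ : ∀ j → sum (λ v → ⟦ f v ≟ j ⟧) ≡ σ j
      sizes′ j = begin
        sum (λ v → ⟦ f v ≟ j ⟧)   ≡⟨ counts-split (λ v → ⟦ f v ≟ j ⟧) ⟨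
        _                         ≡⟨ cong₂ _+_ (counts fzero j) (counts (fsuc fzero) j) ⟩
        β j + (σ j ∸ β j)         ≡⟨ m+[n∸m]≡n (β≤σ j) ⟩
        σ j                       ∎
        where open ≡-Reasoning

      unused-vertices : sum (λ w → ⟦ β (f w) ℕₚ.≟ 0 ⟧) ≡ unused σ β
      unused-vertices = trans (sum-∘ (λ j → ⟦ β j ℕₚ.≟ 0 ⟧) f)
        (sum-cong-≗ λ j → cong (⟦ β j ℕₚ.≟ 0 ⟧ *_) (sizes′ j))

      outside⇒not-full : ∀ u → side u ≡ fsuc fzero → β (f u) ≢ σ (f u)
      outside⇒not-full u su β≡σ = <⇒≱ z<s (begin
        1                                             ≡⟨ cong₂ _*_ (⟦⟧-true (side u ≟ fsuc fzero) su) (⟦⟧-true (f u ≟ f u) refl) ⟨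
        ⟦ side u ≟ fsuc fzero ⟧ * ⟦ f u ≟ f u ⟧       ≤⟨ term≤sum (λ v → ⟦ side v ≟ fsuc fzero ⟧ * ⟦ f v ≟ f u ⟧) u ⟩
        sum (λ v → ⟦ side v ≟ fsuc fzero ⟧ * ⟦ f v ≟ f u ⟧) ≡⟨ counts (fsuc fzero) (f u) ⟩
        σ (f u) ∸ β (f u)                             ≡⟨ m≤n⇒m∸n≡0 (≤-reflexive (sym β≡σ)) ⟩
        0                                             ∎)
        where open ≤-Reasoning

      small : ∀ u → side u ≢ fzero → β (f u) ≤ q
      small u su with full⊎small (f u) | side u in eq
      ... | inj₂ β≤q | _          = β≤q
      ... | inj₁ _   | fzero      = contradiction refl su
      ... | inj₁ β≡σ | fsuc fzero = contradiction β≡σ (outside⇒not-full u eq)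

      layout : Layout β σ f
      layout = record
        { insideCounts = counts fzero
        ; sizes        = sizes′
        ; room         = λ u su → ≤-<-trans (*-monoˡ-≤ (Δ G) (small u su))
                           (subst (q * Δ G <_) (sym unused-vertices) enough)
        }

  equitablyColorable-by-counts :
    ∀ k s q l r → r ≤ k → order G ≡ r + k * s → q ≤ s → s ≤ l * q →
    q * Δ G + (sum inside + l * suc s) < order G → EquitablyColorable G k
  equitablyColorable-by-counts k s q l r r≤k n≡ q≤s s≤lq bound =
    let σ , ∑σ , s≤σ , σ≤1+s = balanced k s r r≤k
        ∑σ≡n = trans ∑σ (sym n≡)
        β , β≤σ , ∑β , full⊎small , ∑σ≤ =
          fill (suc s) q z<s l (sum inside) σ σ≤1+s (λ j → ≤-trans q≤s (s≤σ j)) (s≤s s≤lq)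
            (≤-trans (m+n≤o⇒n≤o (q * Δ G) (<⇒≤ bound)) (≤-reflexive (sym ∑σ≡n)))
        f , L = counts⇒layout β σ q β≤σ ∑β ∑σ≡n full⊎small
          (+-cancelʳ-< _ _ (unused σ β) (<-≤-trans bound (≤-trans (≤-reflexive (sym ∑σ≡n)) ∑σ≤)))
        f′ , proper , sizes = layout⇒proper β σ f L
        near : ∀ i j → classSize G f′ i ≤ suc (classSize G f′ j)
        near i j = subst₂ (λ x y → x ≤ suc y) (sym (sizes i)) (sym (sizes j))
                     (≤-trans (σ≤1+s i) (s≤s (s≤σ j)))
    in f′ , proper , λ i j → ∣m-n∣≤1 (near i j) (near j i)
    where
    ∣m-n∣≤1 : ∀ {m n} → m ≤ suc n → n ≤ suc m → ℕ.∣ m - n ∣ ≤ 1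
    ∣m-n∣≤1 {zero}  {n}     _    n≤1  = n≤1
    ∣m-n∣≤1 {suc m} {zero}  m≤1  _    = m≤1
    ∣m-n∣≤1 {suc m} {suc n} m≤ n≤ = ∣m-n∣≤1 (s≤s⁻¹ m≤) (s≤s⁻¹ n≤)

-- Choice of parameters and the numerical estimate.

bipartition-small-first : ∀ G → Bipartite G →
  ∃ λ side → Proper G side × 2 * sum (λ v → ⟦ side v ≟ fzero ⟧) ≤ order G
bipartition-small-first G (side , proper)
  with 2 * sum (λ v → ⟦ side v ≟ fzero ⟧) ≤? order G
... | yes 2b≤n = side , proper , 2b≤n
... | no  2b≰n = opposite ∘ side ,
  (λ u v u~v eq → proper u v u~v
    (trans (sym (opposite-involutive (side u))) (trans (cong opposite eq) (opposite-involutive (side v))))) ,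
  subst (λ x → 2 * x ≤ order G) (sym (sum-cong-≗ flip)) (begin
    a + (a + 0)    ≤⟨ +-monoˡ-≤ (a + 0) (<⇒≤ a<b) ⟩
    b + (a + 0)    ≡⟨ cong (b +_) (+-identityʳ a) ⟩
    b + a          ≡⟨ split ⟩
    order G        ∎)
  where
  open ≤-Reasoning
  b a : ℕ
  b = sum (λ v → ⟦ side v ≟ fzero ⟧)
  a = sum (λ v → ⟦ side v ≟ fsuc fzero ⟧)
  split : b + a ≡ order G
  split = sides-split G side proper
  flip : ∀ v → ⟦ opposite (side v) ≟ fzero ⟧ ≡ ⟦ side v ≟ fsuc fzero ⟧
  flip v with side v
  ... | fzero      = refl
  ... | fsuc fzero = refl
  a<b : a < b
  a<b = +-cancelˡ-< b a b (begin-strict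
    b + a          ≡⟨ split ⟩
    order G        <⟨ ≰⇒> 2b≰n ⟩
    b + (b + 0)    ≡⟨ cong (b +_) (+-identityʳ b) ⟩
    b + b          ∎)

-- Measured in sixteenths of `n`: `q * d` costs at most five, since `d * s ≤ 2 * n` and
-- `16 * d ≤ n`; `b` costs eight; `8 * s` costs two, since `128 ≤ d`. The last sixteenth exceeds the
-- constant 8, since `128 < n`.
count-bound : ∀ n d K s b q → 200 ≤ d → 16 * d ≤ n → d + 2 ≤ 2 * K → K * s ≤ n →
              2 * b ≤ n → 8 * q ≤ s + 8 → q * d + (b + 8 * suc s) < n
count-bound n d K s b q 200≤d 16d≤n d+2≤2K Ks≤n 2b≤n 8q≤s+8 =
  *-cancelˡ-< 16 _ _ (begin-strict
    16 * (q * d + (b + 8 * suc s))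
      ≡⟨ regroup q d b s ⟩
    2 * (8 * q * d) + 8 * (2 * b) + 128 * s + 128
      ≤⟨ +-monoˡ-≤ 128 (+-monoˡ-≤ (128 * s) (+-mono-≤ (*-monoʳ-≤ 2 (*-monoˡ-≤ d 8q≤s+8)) (*-monoʳ-≤ 8 2b≤n))) ⟩
    2 * ((s + 8) * d) + 8 * n + 128 * s + 128
      ≡⟨ regroup₂ s d n ⟩
    2 * (d * s) + 16 * d + 8 * n + 128 * s + 128
      ≤⟨ +-monoˡ-≤ 128 (+-mono-≤ (+-monoˡ-≤ (8 * n) (+-mono-≤ (*-monoʳ-≤ 2 ds≤2n) 16d≤n)) 128s≤2n) ⟩
    2 * (2 * n) + n + 8 * n + 2 * n + 128
      ≡⟨ regroup₃ n ⟩
    15 * n + 128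
      <⟨ +-monoʳ-< (15 * n) 128<n ⟩
    15 * n + n
      ≡⟨ regroup₄ n ⟩
    16 * n ∎)
  where
  open ≤-Reasoning
  regroup : ∀ q d b s → 16 * (q * d + (b + 8 * suc s)) ≡ 2 * (8 * q * d) + 8 * (2 * b) + 128 * s + 128
  regroup = solve-∀
  regroup₂ : ∀ s d n → 2 * ((s + 8) * d) + 8 * n + 128 * s + 128 ≡ 2 * (d * s) + 16 * d + 8 * n + 128 * s + 128
  regroup₂ = solve-∀
  regroup₃ : ∀ n → 2 * (2 * n) + n + 8 * n + 2 * n + 128 ≡ 15 * n + 128
  regroup₃ = solve-∀
  regroup₄ : ∀ n → 15 * n + n ≡ 16 * n
  regroup₄ = solve-∀
  ds≤2n : d * s ≤ 2 * n
  ds≤2n = begin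
    d * s        ≤⟨ *-monoˡ-≤ s (≤-trans (m≤m+n d 2) d+2≤2K) ⟩
    2 * K * s    ≡⟨ *-assoc 2 K s ⟩
    2 * (K * s)  ≤⟨ *-monoʳ-≤ 2 Ks≤n ⟩
    2 * n        ∎
  128s≤2n : 128 * s ≤ 2 * n
  128s≤2n = ≤-trans (*-monoˡ-≤ s (≤-trans (m≤m+n 128 72) 200≤d)) ds≤2n
  128<n : 128 < n
  128<n = <-≤-trans (≤-trans (m≤m+n 129 71) 200≤d) (≤-trans (m≤n*m d 16) 16d≤n)

equitablyColorable : ∀ G → Bipartite G → 200 ≤ Δ G → 16 * Δ G ≤ order G →
                     EquitablyColorable G (⌈ Δ G /2⌉ + 1)
equitablyColorable G bip 200≤Δ 16Δ≤n with bipartition-small-first G bip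
... | side , proper , 2b≤n =
  subst (EquitablyColorable G) (+-comm 1 ⌈ Δ G /2⌉)
    (equitablyColorable-by-counts G side proper K s q 8 (N ℕ.% K)
      (<⇒≤ (ℕ.m%n<n N K)) n≡ q≤s (<⇒≤ s<8q)
      (count-bound N (Δ G) K s _ q 200≤Δ 16Δ≤n Δ+2≤2K
        (≤-trans (m≤n+m (K * s) (N ℕ.% K)) (≤-reflexive (sym n≡))) 2b≤n 8q≤s+8))
  where
  -- Written as a successor, so that it is visibly nonzero as a divisor.
  K = suc ⌈ Δ G /2⌉
  N = order G
  s = N ℕ./ K
  -- The least `q` with `s < 8 * q`: eight quotas absorb any remainder, while `8 * q ≤ s + 8` keeps
  -- `q * Δ G` small.
  q = suc (s ℕ./ 8)

  n≡ : N ≡ N ℕ.% K + K * s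
  n≡ = trans (ℕ.m≡m%n+[m/n]*n N K) (cong (N ℕ.% K +_) (*-comm s K))

  Δ+2≤2K : Δ G + 2 ≤ 2 * K
  Δ+2≤2K = begin
    Δ G + 2                              ≡⟨ cong (_+ 2) (⌊n/2⌋+⌈n/2⌉≡n (Δ G)) ⟨
    ℕ.⌊ Δ G /2⌋ + ⌈ Δ G /2⌉ + 2          ≤⟨ +-monoˡ-≤ 2 (+-monoˡ-≤ ⌈ Δ G /2⌉ (⌊n/2⌋≤⌈n/2⌉ (Δ G))) ⟩
    ⌈ Δ G /2⌉ + ⌈ Δ G /2⌉ + 2            ≡⟨ double ⌈ Δ G /2⌉ ⟩
    2 * K                                ∎
    where
    open ≤-Reasoning
    double : ∀ h → h + h + 2 ≡ 2 * suc h
    double = solve-∀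

  K≤n : K ≤ N
  K≤n = begin
    suc ⌈ Δ G /2⌉        ≤⟨ s≤s (⌈n/2⌉≤n (Δ G)) ⟩
    1 + Δ G              ≤⟨ +-monoˡ-≤ (Δ G) (≤-trans (m≤m+n 1 199) 200≤Δ) ⟩
    Δ G + Δ G            ≡⟨ cong (Δ G +_) (+-identityʳ (Δ G)) ⟨
    2 * Δ G              ≤⟨ *-monoˡ-≤ (Δ G) (m≤m+n 2 14) ⟩
    16 * Δ G             ≤⟨ 16Δ≤n ⟩
    N                    ∎
    where open ≤-Reasoning

  q≤s : q ≤ s
  -- `s` is positive because `K ≤ N`, and then `s / 8 < s`.
  q≤s = ℕ.m/n<m s 8 ⦃ >-nonZero (ℕ.m≥n⇒m/n>0 K≤n) ⦄ (m≤m+n 2 6)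

  8q≡ : 8 * q ≡ s ℕ./ 8 * 8 + 8
  8q≡ = trans (*-suc 8 (s ℕ./ 8)) (trans (+-comm 8 _) (cong (_+ 8) (*-comm 8 (s ℕ./ 8))))

  8q≤s+8 : 8 * q ≤ s + 8
  8q≤s+8 = ≤-trans (≤-reflexive 8q≡) (+-monoˡ-≤ 8 (ℕ.m/n*n≤m s 8))

  s<8q : s < 8 * q
  s<8q = begin-strict
    s                           ≡⟨ ℕ.m≡m%n+[m/n]*n s 8 ⟩
    s ℕ.% 8 + s ℕ./ 8 * 8       <⟨ +-monoˡ-< (s ℕ./ 8 * 8) (ℕ.m%n<n s 8) ⟩
    8 + s ℕ./ 8 * 8             ≡⟨ +-comm 8 (s ℕ./ 8 * 8) ⟩
    s ℕ./ 8 * 8 + 8             ≡⟨ 8q≡ ⟨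
    8 * q                       ∎
    where open ≤-Reasoning

open import Data.Integer.Base using (+_)

-- From the real hypothesis to natural numbers.

-- After clearing denominators, `2 * (n + 1) ≤ 32 * d < 41 * d`, as `d` is positive. The extra 1
-- serves as the uniform gap in `<ℝ`.
1+n<41/2*d : ∀ n d → n < 16 * d → + n / 1 ℚ.+ 1ℚ ℚ.< + 41 / 2 ℚ.* (+ d / 1)
1+n<41/2*d n d n<16d = ℚₚ.toℚᵘ-cancel-< (begin-strict
  toℚᵘ (+ n / 1 ℚ.+ 1ℚ)                           ≃⟨ ℚₚ.toℚᵘ-homo-+ (+ n / 1) 1ℚ ⟩
  toℚᵘ (+ n / 1) ℚᵘ.+ ℚᵘ.1ℚᵘ                      ≃⟨ ℚᵘₚ.+-congˡ ℚᵘ.1ℚᵘ (ℚₚ.toℚᵘ-fromℚᵘ (ℚᵘ.mkℚᵘ (+ n) 0)) ⟩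
  ℚᵘ.mkℚᵘ (+ n) 0 ℚᵘ.+ ℚᵘ.1ℚᵘ                     <⟨ ℚᵘ.*<* cross ⟩
  ℚᵘ.mkℚᵘ (+ 41) 1 ℚᵘ.* ℚᵘ.mkℚᵘ (+ d) 0           ≃⟨ ℚᵘₚ.*-congˡ {ℚᵘ.mkℚᵘ (+ 41) 1} (ℚₚ.toℚᵘ-fromℚᵘ (ℚᵘ.mkℚᵘ (+ d) 0)) ⟨
  toℚᵘ (+ 41 / 2) ℚᵘ.* toℚᵘ (+ d / 1)             ≃⟨ ℚₚ.toℚᵘ-homo-* (+ 41 / 2) (+ d / 1) ⟨
  toℚᵘ (+ 41 / 2 ℚ.* (+ d / 1))                   ∎)
  where
  0<d : 0 < d
  0<d = *-cancelˡ-< 16 0 d (≤-<-trans z≤n n<16d)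
  open ℚᵘₚ.≤-Reasoning
  crossℕ : (n + 1) * 2 < 41 * d
  crossℕ = ≤-<-trans (*-monoˡ-≤ 2 (≤-trans (≤-reflexive (+-comm n 1)) n<16d))
    (subst (_< 41 * d) (eq d) (*-monoˡ-< d ⦃ >-nonZero 0<d ⦄ {32} {41} (m≤m+n 33 8)))
    where
    eq : ∀ d → 32 * d ≡ 16 * d * 2
    eq = solve-∀
  cross : (+ n ℤ.* + 1 ℤ.+ + 1 ℤ.* + 1) ℤ.* + 2 ℤ.< (+ 41 ℤ.* + d) ℤ.* + 1
  cross = subst₂ ℤ._<_
    (trans (ℤₚ.pos-* (n + 1) 2) (cong (λ x → (x ℤ.+ + 1) ℤ.* + 2) (sym (ℤₚ.*-identityʳ (+ n)))))
    (trans (ℤₚ.pos-* 41 d) (sym (ℤₚ.*-identityʳ (+ 41 ℤ.* + d))))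
    (ℤ.+<+ crossℕ)

-- Since `≤ℝ` is a negated strict inequality, the argument is by contradiction: if `n < 16 * d`, the
-- approximations of `ζ` times `d` eventually exceed `n + 1`.
ζd≤n⇒16d≤n : ∀ ζ → fromℚ (+ 41 / 2) <ℝ ζ → ∀ d n →
             ζ *ℝ fromℕ d ≤ℝ fromℕ n → 16 * d ≤ n
ζd≤n⇒16d≤n ζ (ε , 0<ε , N , 41/2+ε<ζ) d n ζd≤n = ≮⇒≥ λ n<16d →
  ζd≤n (1ℚ , ℚₚ.positive⁻¹ 1ℚ , N , λ m N≤m → begin-strict
    + n / 1 ℚ.+ 1ℚ            <⟨ 1+n<41/2*d n d n<16d ⟩
    + 41 / 2 ℚ.* (+ d / 1)    ≤⟨ ℚₚ.*-monoʳ-≤-nonNeg (+ d / 1) ⦃ ℚₚ.normalize-nonNeg d 1 ⦄ (41/2≤ζ m N≤m) ⟩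
    seq ζ m ℚ.* (+ d / 1)     ∎)
  where
  open ℚₚ.≤-Reasoning
  41/2≤ζ : ∀ m → N ≤ m → + 41 / 2 ℚ.≤ seq ζ m
  41/2≤ζ m N≤m = begin
    + 41 / 2              ≡⟨ ℚₚ.+-identityʳ (+ 41 / 2) ⟨
    + 41 / 2 ℚ.+ 0ℚ       ≤⟨ ℚₚ.+-monoʳ-≤ (+ 41 / 2) (ℚₚ.<⇒≤ 0<ε) ⟩
    + 41 / 2 ℚ.+ ε        ≤⟨ ℚₚ.<⇒≤ (41/2+ε<ζ m N≤m) ⟩
    seq ζ m               ∎

theorem1p2 : (ζ : ℝ) → fromℚ (+ 41 / 2) <ℝ ζ →
    ∃ λ c → 0 < c × ((G : Graph) → Bipartite G → Δ G ≥ c →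
    ζ *ℝ fromℕ (Δ G) ≤ℝ fromℕ (order G) →
    χₑ G ≤ ⌈ Δ G /2⌉ + 1)
theorem1p2 ζ 41/2<ζ = 200 , z<s , λ G bip 200≤Δ ζΔ≤n →
  -- Minimality of `χₑ G`: any equitable colouring bounds it by its number of colours.
  proj₂ (proj₂ (∃-least-equitable G)) (⌈ Δ G /2⌉ + 1)
    (equitablyColorable G bip 200≤Δ (ζd≤n⇒16d≤n ζ 41/2<ζ (Δ G) (order G) ζΔ≤n))
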